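{- Let $k\ge 2$, $m\ge 0$, $1\le s\le k$, and $N=mk+s$. There are (recursively defined) bijections $$\mathcal{D}_{N,k}(132)\longleftrightarrow \mathcal{F}^{(k)}_{m,s},\qquad \mathcal{D}_{N,k}(231)\longleftrightarrow \mathcal{F}^{(k)}_{m,s}.$$ Consequently, $$|\mathcal{D}_{N,k}(132)|=|\mathcal{D}_{N,k}(231)|=\frac{s}{N}\binom{N}{m}.$$
   Context: For $\pi=\pi_1\cdots\pi_N\in S_N$ let $\operatorname{Des}(\pi)=\{i\in[N-1]:\pi_i>\pi_{i+1}\}$. For $k\ge2$, $N\ge1$, let $\mathcal{D}_{N,k}=\{\pi\in S_N:\operatorname{Des}(\pi)=\{k,2k,\ldots,k\lfloor (N-1)/k\rfloor\}\}$. For a pattern $p$, $\mathcal{D}_{N,k}(p)$ is the set of elements of $\mathcal{D}_{N,k}$ avoiding $p$, i.e. having no subsequence (not necessarily consecutive) in the same relative order as $p$. A complete ordered $k$-ary tree is a rooted plane tree in which every vertex is either a leaf or an internal vertex with exactly $k$ ordered children; a single leaf is allowed (0 internal vertices). $\mathcal{F}^{(k)}_{m,s}$ denotes the set of ordered forests (sequences) of $s$ complete ordered $k$-ary trees with altogether $m$ internal vertices. -}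

module Defs where

open import Data.Fin.Base as Fin using (Fin; toℕ)
open import Data.Fin.Permutation using (Permutation′; _⟨$⟩ʳ_)
open import Data.Nat.Base
open import Data.Product.Base using (Σ-syntax; ∃-syntax; ∃₂; _×_; proj₁)
open import Data.Vec.Base using (Vec; []; _∷_; lookup)
open import Function.Bundles using (Bijection; _⇔_)
open import Level using (Level; 0ℓ)
open import Relation.Binary.Bundles using (Setoid)
open import Relation.Binary.Core using (_Preserves_⟶_)
import Relation.Binary.Construct.On as On
open import Relation.Binary.PropositionalEquality
  using (_≡_; setoid; _→-setoid_)
open import Relation.Nullary.Negation using (¬_)
open import Relation.Unary using (Pred; _≐_)

private
  variable
    a ℓ : Level
    k l n N : ℕ

-- Positions are numbered from 1 in the usual one-line notation, while
-- `Fin N` starts at 0.  Values are only ever compared with each other, so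
-- they need no such shift.
position : Fin N → ℕ
position i = suc (toℕ i)

-- The range 1 ≤ i ≤ N - 1 is forced by i and i + 1 both being positions.
Des : Permutation′ N → Pred ℕ 0ℓ
Des π i = ∃₂ λ a b →
  position a ≡ i × position b ≡ suc i × π ⟨$⟩ʳ a Fin.> π ⟨$⟩ʳ b

-- {k, 2k, …, k⌊(N-1)/k⌋}
Multiples : (N k : ℕ) → .{{NonTrivial k}} → Pred ℕ 0ℓ
Multiples N k i = ∃[ j ] 1 ≤ j × j ≤ (N ∸ 1) / k × i ≡ k * j
  where
  instance
    _ : NonZero k
    _ = nonTrivial⇒nonZero k

InD : (N k : ℕ) → .{{NonTrivial k}} → Pred (Permutation′ N) 0ℓ
InD N k π = Des π ≐ Multiples N k

-- A pattern in one-line notation; only the relative order of its entries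
-- matters.
Pattern : ℕ → Set
Pattern = Vec ℕ

p132 p231 : Pattern 3
p132 = 1 ∷ 3 ∷ 2 ∷ []
p231 = 2 ∷ 3 ∷ 1 ∷ []

Contains : Permutation′ N → Pattern l → Set
Contains {N} {l} π p = Σ[ f ∈ (Fin l → Fin N) ]
  f Preserves Fin._<_ ⟶ Fin._<_ ×
  (∀ i j → lookup p i < lookup p j ⇔ π ⟨$⟩ʳ f i Fin.< π ⟨$⟩ʳ f j)

Avoids : Pattern l → Pred (Permutation′ N) 0ℓ
Avoids p π = ¬ Contains π p

-- Elements are identified when their underlying permutations agree
-- pointwise; the membership proofs are ignored.
𝒟 : (N k : ℕ) → .{{NonTrivial k}} → Pattern l → Setoid 0ℓ 0ℓ
𝒟 N k p = On.setoid {B = Σ[ π ∈ Permutation′ N ] InD N k π × Avoids p π}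
  (Fin N →-setoid Fin N) (λ x → proj₁ x ⟨$⟩ʳ_)

data Tree (k : ℕ) : Set where
  leaf : Tree k
  node : Vec (Tree k) k → Tree k

mutual
  internal : Tree k → ℕ
  internal leaf      = 0
  internal (node ts) = suc (internals ts)

  internals : Vec (Tree k) n → ℕ
  internals []       = 0
  internals (t ∷ ts) = internal t + internals ts

-- Equality on ℕ is proof-irrelevant, so propositional equality on these
-- pairs is equality of the underlying forests.
ℱ : (k m s : ℕ) → Setoid 0ℓ 0ℓ
ℱ k m s = setoid (Σ[ ts ∈ Vec (Tree k) s ] internals ts ≡ m)

HasCardinality : Setoid a ℓ → ℕ → Set _
HasCardinality S c = Bijection S (setoid (Fin c))

{-# OPTIONS --safe #-}
module Submission where

-- In the Lehmer code c of a permutation π, where c i counts the later entries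
-- smaller than π i, a descent at i is a strict descent of c, and π avoids 132
-- exactly when c is weakly decreasing.  Hence a 132-avoiding permutation with
-- given descents is built from right to left: at a non-descent the code entry
-- is repeated, at a descent any larger admissible entry may be chosen.
-- Reversal turns 231 into 132 and exchanges ascents and descents, so the same
-- codes describe both families.  In either case their number satisfies the
-- recursion for ordered forests obtained by removing the leftmost root, whose
-- solution w m s is given by (s + m k) w m s = s * ((s + m k) C m).

open import Defs
open import Data.Bool.Base using (Bool; true; false; not)
open import Data.Empty using (⊥-elim)
open import Data.Fin.Base as Fin
  using (Fin; zero; suc; toℕ; fromℕ<; inject₁; inject≤; opposite; punchIn)
open import Data.Fin.Patterns using (0F; 1F; 2F)
open import Data.Fin.Permutation as Perm
  using (Permutation′; _⟨$⟩ʳ_; _⟨$⟩ˡ_; _≈_; _∘ₚ_; insert; remove; flip;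
         inverseˡ; inverseʳ; insert-punchIn; punchIn-permute)
open import Data.Fin.Properties
  using (toℕ-injective; toℕ-fromℕ<; toℕ-inject₁; toℕ-inject≤; toℕ<n; toℕ≤pred[n];
         opposite-prop; opposite-involutive; inject≤-injective;
         punchIn-cancel-≤; punchIn-mono-≤; punchIn-injective; +↔⊎)
open import Data.Integer.Base as ℤ using (+_)
import Data.Integer.Properties as ℤ
open import Data.List.Base as List using (applyUpTo; [_])
open import Data.List.Properties using (applyUpTo-∷ʳ)
open import Data.Nat.Base as ℕ hiding (_/_)
open import Data.Nat.Combinatorics using (_C_; nCk+nC[k+1]≡[n+1]C[k+1]; nC1≡n)
open import Data.Nat.Divisibility
  using (_∣_; divides; _∣?_; n∣m*n; ∣m∣n⇒∣m+n; ∣m+n∣m⇒∣n; >⇒∤)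
open import Data.Nat.DivMod using (m*n/n≡m; m/n*n≤m; /-monoˡ-≤)
open import Data.Nat.ListAction using (sum)
open import Data.Nat.ListAction.Properties using (sum-++)
open import Data.Nat.Properties
open import Data.Nat.Tactic.RingSolver using (solve-∀)
open import Data.Product.Base using (Σ; Σ-syntax; ∃-syntax; _×_; _,_; proj₁; proj₂)
open import Data.Product.Function.Dependent.Propositional using () renaming (congˡ to Σ-congˡ)
open import Data.Product.Function.NonDependent.Propositional using (_×-⇔_)
open import Data.Rational.Base as ℚ using (_/_)
import Data.Rational.Properties as ℚ
import Data.Rational.Unnormalised.Base as ℚᵘ
import Data.Rational.Unnormalised.Properties as ℚᵘ
open import Data.Sum.Base using (_⊎_; inj₁; inj₂)
open import Data.Sum.Function.Propositional using (_⊎-↔_)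
open import Data.Unit.Base using (⊤; tt)
open import Data.Vec.Base as Vec
  using (Vec; []; _∷_; _++_; lookup; replicate; splitAt; tabulate)
open import Data.Vec.Properties using (++-injective; lookup∘tabulate; lookup-map)
open import Function.Base using (_∘_; const)
open import Function.Bundles using (_⇔_; _↔_; mk⇔; mk↔ₛ′; Bijection; Equivalence; Injection)
import Function.Construct.Composition as Composition
open import Function.Construct.Composition using (_⇔-∘_)
open import Function.Construct.Symmetry using (⇔-sym)
open import Function.Properties.Inverse
  using (Inverse⇒Bijection; ↔-refl; ↔-sym; ↔-trans; ↔⇒↣)
open import Function.Related.TypeIsomorphisms using (Σ-assoc; ¬-cong-⇔)
open import Level using (0ℓ)
import Relation.Binary.Construct.On as On
open import Relation.Binary.PropositionalEquality
  using (_≡_; _≢_; refl; sym; trans; cong; cong₂; subst; subst₂;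
         setoid; _→-setoid_; module ≡-Reasoning)
open import Relation.Nullary.Decidable
  using (Dec; yes; no; does; does-⇔; dec-true; dec-false)
open import Relation.Nullary.Negation using (¬_; contradiction)
open import Relation.Unary using (Pred)

open ≡-Reasoning

private
  variable
    n : ℕ

-- Finite sums and weighted sums over descent words.

∑ : ℕ → (ℕ → ℕ) → ℕ
∑ n f = sum (applyUpTo f n)

∑-last : ∀ n f → ∑ (suc n) f ≡ ∑ n f + f n
∑-last n f = begin
  sum (applyUpTo f (suc n))              ≡⟨ cong sum (applyUpTo-∷ʳ f n) ⟨
  sum (applyUpTo f n List.++ [ f n ])    ≡⟨ sum-++ (applyUpTo f n) _ ⟩
  ∑ n f + (f n + 0)                      ≡⟨ cong (_+_ (∑ n f)) (+-identityʳ (f n)) ⟩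
  ∑ n f + f n                            ∎

∑-cong : ∀ n {f g : ℕ → ℕ} → (∀ i → f i ≡ g i) → ∑ n f ≡ ∑ n g
∑-cong zero    f≗g = refl
∑-cong (suc n) f≗g = cong₂ _+_ (f≗g 0) (∑-cong n (f≗g ∘ suc))

∑-zero : ∀ n → ∑ n (const 0) ≡ 0
∑-zero zero    = refl
∑-zero (suc n) = ∑-zero n

∑-distrib-+ : ∀ n (f g : ℕ → ℕ) → ∑ n (λ i → f i + g i) ≡ ∑ n f + ∑ n g
∑-distrib-+ zero    f g = refl
∑-distrib-+ (suc n) f g
  rewrite ∑-distrib-+ n (f ∘ suc) (g ∘ suc) =
  lemma (f 0) (g 0) (∑ n (f ∘ suc)) (∑ n (g ∘ suc))
  where
  lemma : ∀ a b x y → a + b + (x + y) ≡ a + x + (b + y)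
  lemma = solve-∀

-- The sum of f (height bs c) over all c : Code bs, see Σ-Code↔Fin.
weigh : Vec Bool n → (ℕ → ℕ) → ℕ
weigh []           f = f 0
weigh (false ∷ bs) f = weigh bs (f ∘ suc)
weigh (true ∷ bs)  f = weigh bs (λ h → ∑ (suc h) f)

weigh-cong : ∀ (bs : Vec Bool n) {f g} → (∀ h → f h ≡ g h) → weigh bs f ≡ weigh bs g
weigh-cong []           f≗g = f≗g 0
weigh-cong (false ∷ bs) f≗g = weigh-cong bs (f≗g ∘ suc)
weigh-cong (true ∷ bs)  f≗g = weigh-cong bs (λ h → ∑-cong (suc h) f≗g)

weigh-zero : ∀ (bs : Vec Bool n) → weigh bs (const 0) ≡ 0
weigh-zero []           = refl
weigh-zero (false ∷ bs) = weigh-zero bs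
weigh-zero (true ∷ bs)  = trans (weigh-cong bs (λ h → ∑-zero (suc h))) (weigh-zero bs)

weigh-distrib-+ : ∀ (bs : Vec Bool n) f g →
  weigh bs (λ h → f h + g h) ≡ weigh bs f + weigh bs g
weigh-distrib-+ []           f g = refl
weigh-distrib-+ (false ∷ bs) f g = weigh-distrib-+ bs (f ∘ suc) (g ∘ suc)
weigh-distrib-+ (true ∷ bs)  f g = trans
  (weigh-cong bs (λ h → ∑-distrib-+ (suc h) f g))
  (weigh-distrib-+ bs (λ h → ∑ (suc h) f) (λ h → ∑ (suc h) g))

-- Linearity in the weight. In `weigh-nonmultiples` it moves a sum over the kernel parameter `d`
-- outside the walk over the Booleans.
weigh-∑ : ∀ (bs : Vec Bool n) l (F : ℕ → ℕ → ℕ) →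
  weigh bs (λ h → ∑ l (λ d → F d h)) ≡ ∑ l (λ d → weigh bs (F d))
weigh-∑ bs zero    F = weigh-zero bs
weigh-∑ bs (suc l) F = trans
  (weigh-distrib-+ bs (F 0) (λ h → ∑ l (λ d → F (suc d) h)))
  (cong (_+_ (weigh bs (F 0))) (weigh-∑ bs l (F ∘ suc)))

-- Forest numbers and their closed form.

module _ (k : ℕ) where

  -- The recursion removes the leftmost root: either a leaf disappears, or an
  -- internal vertex is replaced by its k subtrees.
  forests : ℕ → ℕ → ℕ
  forests zero    s       = 1
  forests (suc m) zero    = 0
  forests (suc m) (suc s) = forests (suc m) s + forests m (k + s)

  -- The recursion telescopes from `forests (suc m) 0 = 0`. The left side is what a descent produces
  -- when the current weight is `forests m` shifted by `k`.
  forests-∑ : ∀ m s → ∑ s (λ i → forests m (k + i)) ≡ forests (suc m) s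
  forests-∑ m zero    = refl
  forests-∑ m (suc s) = trans (∑-last s _) (cong (_+ forests m (k + s)) (forests-∑ m s))

absorption : ∀ n m → suc m * (suc n C suc m) ≡ suc n * (n C m)
absorption n       zero    = trans (*-identityˡ (suc n C 1))
  (trans (nC1≡n (suc n)) (sym (*-identityʳ (suc n))))
absorption zero    (suc m) = *-zeroʳ m
absorption (suc n) (suc m) = begin
  (2 + m) * (suc (suc n) C suc (suc m))
    ≡⟨ cong ((2 + m) *_) (nCk+nC[k+1]≡[n+1]C[k+1] (suc n) (suc m)) ⟨
  (2 + m) * ((suc n C suc m) + (suc n C suc (suc m)))
    ≡⟨ *-distribˡ-+ (2 + m) (suc n C suc m) (suc n C suc (suc m)) ⟩
  (suc n C suc m) + suc m * (suc n C suc m) + (2 + m) * (suc n C suc (suc m))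
    ≡⟨ cong₂ (λ x y → (suc n C suc m) + x + y) (absorption n m) (absorption n (suc m)) ⟩
  (suc n C suc m) + suc n * (n C m) + suc n * (n C suc m)
    ≡⟨ +-assoc (suc n C suc m) _ _ ⟩
  (suc n C suc m) + (suc n * (n C m) + suc n * (n C suc m))
    ≡⟨ cong (_+_ (suc n C suc m)) (*-distribˡ-+ (suc n) (n C m) (n C suc m)) ⟨
  (suc n C suc m) + suc n * ((n C m) + (n C suc m))
    ≡⟨ cong (λ x → (suc n C suc m) + suc n * x) (nCk+nC[k+1]≡[n+1]C[k+1] n m) ⟩
  (2 + n) * (suc n C suc m) ∎

-- Both sides carry the factor n because a and b are only known through n * a
-- and n * b; c and c′ stand for n C m and n C suc m.
cycle-step : ∀ k m s n a b c c′ → n ≡ s + suc m * k →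
  n * a ≡ s * c′ → n * b ≡ (k + s) * c → suc m * (c + c′) ≡ suc n * c →
  n * (suc n * (a + b)) ≡ n * (suc s * (c + c′))
cycle-step k m s n a b c c′ n≡ na nb pascal = begin
  n * (suc n * (a + b))
    ≡⟨ regroup n a b ⟩
  suc n * (n * a + n * b)
    ≡⟨ cong₂ (λ x y → suc n * (x + y)) na nb ⟩
  suc n * (s * c′ + (k + s) * c)
    ≡⟨ split n s k c c′ ⟩
  suc n * s * (c + c′) + k * (suc n * c)
    -- Absorption turns the remaining `c` into a multiple of `c + c′`; its coefficient `k * suc m`
    -- then completes `s` to `n`.
    ≡⟨ cong (λ x → suc n * s * (c + c′) + k * x) pascal ⟨
  suc n * s * (c + c′) + k * (suc m * (c + c′))
    ≡⟨ collect n s k m (c + c′) ⟩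
  n * s * (c + c′) + (s + suc m * k) * (c + c′)
    ≡⟨ cong (λ x → n * s * (c + c′) + x * (c + c′)) n≡ ⟨
  n * s * (c + c′) + n * (c + c′)
    ≡⟨ finish n s (c + c′) ⟩
  n * (suc s * (c + c′)) ∎
  where
  regroup : ∀ n a b → n * (suc n * (a + b)) ≡ suc n * (n * a + n * b)
  regroup = solve-∀
  split : ∀ n s k c c′ → suc n * (s * c′ + (k + s) * c) ≡ suc n * s * (c + c′) + k * (suc n * c)
  split = solve-∀
  collect : ∀ n s k m x → suc n * s * x + k * (suc m * x) ≡ n * s * x + (s + suc m * k) * x
  collect = solve-∀
  finish : ∀ n s x → n * s * x + n * x ≡ n * (suc s * x)
  finish = solve-∀

-- The two terms of the recursion have parameters `(suc m, s)` and `(m, k + s)`, which give the same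
-- total `N = s + suc m * k`. Their binomials therefore share the upper index and combine by
-- Pascal's rule and `absorption`.
forests-closed : ∀ k .{{_ : NonZero k}} m s →
  (s + m * k) * forests k m s ≡ s * ((s + m * k) C m)
forests-closed k zero    s       = cong (_* 1) (+-identityʳ s)
forests-closed k (suc m) zero    = *-zeroʳ (suc m * k)
forests-closed k (suc m) (suc s) = *-cancelˡ-≡ _ _ N {{N≢0}} (trans
  (cycle-step k m s N a b (N C m) (N C suc m) refl
    (forests-closed k (suc m) s) forests-closed′
    (trans (cong (suc m *_) pascal) (absorption N m)))
  (cong (λ x → N * (suc s * x)) pascal))
  where
  N = s + suc m * k
  a = forests k (suc m) s
  b = forests k m (k + s)

  N≢0 : NonZero N
  N≢0 = >-nonZero (<-≤-trans (>-nonZero⁻¹ k) (≤-trans (m≤m+n k (m * k)) (m≤n+m (suc m * k) s)))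

  pascal = nCk+nC[k+1]≡[n+1]C[k+1] N m

  shift : ∀ k m s → k + s + m * k ≡ s + suc m * k
  shift = solve-∀

  forests-closed′ : N * b ≡ (k + s) * (N C m)
  forests-closed′ = subst (λ x → x * b ≡ (k + s) * (x C m)) (shift k m s) (forests-closed k m (k + s))

-- Evaluation of the weighted sums for the two descent words.

descents-at : ∀ n → (ℕ → Bool) → Vec Bool n
descents-at n p = tabulate (p ∘ toℕ)

-- The successor appears because index `i` stands for the descent position `i + 1` in one-line
-- notation.
multiples : (k n : ℕ) → Vec Bool n
multiples k n = descents-at n (λ i → does (k ∣? suc i))

-- The complement of the multiples of k, read from right to left.
nonmultiples : (k n : ℕ) → Vec Bool n
nonmultiples k n = descents-at n (λ i → not (does (k ∣? n ∸ i)))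

-- A non-descent raises the height by one and offers no choice, so a run of them only shifts the
-- weight.
weigh-plateau : ∀ j n p f → (∀ i → i < j → p i ≡ false) →
  weigh (descents-at (j + n) p) f ≡ weigh (descents-at n (λ i → p (j + i))) (λ h → f (j + h))
weigh-plateau zero    n p f flat = refl
weigh-plateau (suc j) n p f flat rewrite flat 0 z<s =
  weigh-plateau j n (p ∘ suc) (f ∘ suc) (λ i i<j → flat (suc i) (s<s i<j))

-- A duality kernel: weighing a step on the height h of `paths d h` amounts to
-- the opposite kind of step on d.  This makes it possible to process the
-- descents of the reversed permutations in the convenient direction.
paths : ℕ → ℕ → ℕ
paths zero    h       = 1
paths (suc d) zero    = 1
paths (suc d) (suc h) = paths d (suc h) + paths (suc d) h

paths-sym : ∀ d h → paths d h ≡ paths h d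
paths-sym zero    zero    = refl
paths-sym zero    (suc h) = refl
paths-sym (suc d) zero    = refl
paths-sym (suc d) (suc h) = trans
  (cong₂ _+_ (paths-sym d (suc h)) (paths-sym (suc d) h))
  (+-comm (paths (suc h) d) (paths h (suc d)))

-- Hockey-stick identity: `paths d h` is the binomial coefficient `(d + h) C d`, and its recursion
-- telescopes in `d`.
∑-pathsˡ : ∀ d h → ∑ (suc d) (λ i → paths i h) ≡ paths d (suc h)
∑-pathsˡ zero    h = refl
∑-pathsˡ (suc d) h = trans (∑-last (suc d) (λ i → paths i h))
  (cong (_+ paths (suc d) h) (∑-pathsˡ d h))

∑-pathsʳ : ∀ d h → ∑ (suc h) (paths d) ≡ paths (suc d) h
∑-pathsʳ d h = trans (∑-cong (suc h) (paths-sym d)) (trans (∑-pathsˡ h d) (paths-sym h (suc d)))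

module _ (k′ : ℕ) where
  private
    k = suc k′

  does-multiple : ∀ m → does (k ∣? m * k) ≡ true
  does-multiple m = dec-true (k ∣? m * k) (n∣m*n m)

  does-shift : ∀ m i → does (k ∣? m * k + i) ≡ does (k ∣? i)
  does-shift m i = does-⇔ (mk⇔ (λ d → ∣m+n∣m⇒∣n d (n∣m*n m)) (∣m∣n⇒∣m+n (n∣m*n m)))
    (k ∣? m * k + i) (k ∣? i)

  does-small : ∀ i → suc i < k → does (k ∣? suc i) ≡ false
  does-small i i<k = dec-false (k ∣? suc i) (>⇒∤ i<k)

  -- Induction on the number `m` of remaining blocks, with `j` counting those already absorbed into
  -- the weight. A block consists of `k′` non-descents, which shift the argument to `k + h`, and one
  -- descent, whose sum `forests-∑` evaluates. A general `p` is allowed because dropping a block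
  -- preserves the divisibility test only up to pointwise equality.
  weigh-multiples : ∀ m r j p → r ≤ k′ → (∀ i → p i ≡ does (k ∣? suc i)) →
    weigh (descents-at (m * k + r) p) (forests k j ∘ suc) ≡ forests k (m + j) (suc r)
  weigh-multiples zero    r j p r≤k′ p≗ = begin
    weigh (descents-at r p) (forests k j ∘ suc)
      ≡⟨ cong (λ x → weigh (descents-at x p) (forests k j ∘ suc)) (+-identityʳ r) ⟨
    weigh (descents-at (r + 0) p) (forests k j ∘ suc)
      ≡⟨ weigh-plateau r 0 p _ (λ i i<r →
           trans (p≗ i) (does-small i (s<s (<-≤-trans i<r r≤k′)))) ⟩
    forests k j (suc (r + 0))
      ≡⟨ cong (forests k j ∘ suc) (+-identityʳ r) ⟩
    forests k j (suc r) ∎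
  weigh-multiples (suc m) r j p r≤k′ p≗ = begin
    weigh (descents-at (suc m * k + r) p) f
      ≡⟨ cong (λ x → weigh (descents-at x p) f) (reindex k′ m r) ⟩
    weigh (descents-at (k′ + suc (m * k + r)) p) f
      ≡⟨ weigh-plateau k′ _ p f (λ i i<k′ → trans (p≗ i) (does-small i (s<s i<k′))) ⟩
    weigh (p (k′ + 0) ∷ rest) (λ h → f (k′ + h))
      ≡⟨ cong (λ x → weigh (x ∷ rest) (λ h → f (k′ + h))) peak ⟩
    weigh rest (λ h → ∑ (suc h) (λ i → forests k j (k + i)))
      ≡⟨ weigh-cong rest (λ h → forests-∑ k j (suc h)) ⟩
    weigh rest (forests k (suc j) ∘ suc)
      ≡⟨ weigh-multiples m r (suc j) _ r≤k′ periodic ⟩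
    forests k (m + suc j) (suc r)
      ≡⟨ cong (λ x → forests k x (suc r)) (+-suc m j) ⟩
    forests k (suc m + j) (suc r) ∎
    where
    f = forests k j ∘ suc
    rest = descents-at (m * k + r) (λ i → p (k′ + suc i))

    reindex : ∀ k′ m r → suc m * suc k′ + r ≡ k′ + suc (m * suc k′ + r)
    reindex = solve-∀

    peak : p (k′ + 0) ≡ true
    peak = trans (p≗ (k′ + 0)) (trans (cong (λ x → does (k ∣? suc x)) (+-comm k′ 0))
      (trans (cong (λ x → does (k ∣? x)) (sym (+-identityʳ k))) (does-multiple 1)))

    periodic : ∀ i → p (k′ + suc i) ≡ does (k ∣? suc i)
    periodic i = trans (p≗ (k′ + suc i)) (trans
      (cong (λ x → does (k ∣? x + suc i)) (sym (+-identityʳ k))) (does-shift 1 (suc i)))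

  -- Through the kernel, `d` takes the part that the height has for `multiples`: a descent raises
  -- `d` by one (`∑-pathsʳ`), and a non-descent becomes a sum over all `i ≤ d` (`∑-pathsˡ`), again
  -- evaluated by `forests-∑`. The induction lowers `r` inside a block and restarts at `k′` when a
  -- block is used up.
  weigh-nonmultiples : ∀ m r d → r ≤ k′ →
    weigh (nonmultiples k (m * k + r)) (paths d) ≡ forests k m (suc (d + r))
  weigh-nonmultiples m (suc r) d r<k′ = begin
    weigh (nonmultiples k (m * k + suc r)) (paths d)
      ≡⟨ cong (λ n → weigh (nonmultiples k n) (paths d)) (+-suc (m * k) r) ⟩
    weigh (not (does (k ∣? suc (m * k + r))) ∷ rest) (paths d)
      ≡⟨ cong (λ b → weigh (not b ∷ rest) (paths d)) (trans
           (cong (λ x → does (k ∣? x)) (sym (+-suc (m * k) r)))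
           (trans (does-shift m (suc r)) (does-small r (s<s r<k′)))) ⟩
    weigh rest (λ h → ∑ (suc h) (paths d))
      ≡⟨ weigh-cong rest (∑-pathsʳ d) ⟩
    weigh rest (paths (suc d))
      ≡⟨ weigh-nonmultiples m r (suc d) (<⇒≤ r<k′) ⟩
    forests k m (suc (suc d + r))
      ≡⟨ cong (forests k m ∘ suc) (+-suc d r) ⟨
    forests k m (suc (d + suc r)) ∎
    where
    rest = nonmultiples k (m * k + r)
  weigh-nonmultiples zero    zero d _ = paths-sym d 0
  weigh-nonmultiples (suc m) zero d _ = begin
    weigh (nonmultiples k (suc m * k + 0)) (paths d)
      ≡⟨ cong (λ n → weigh (nonmultiples k n) (paths d)) (reindex k′ m) ⟩
    weigh (not (does (k ∣? suc (m * k + k′))) ∷ rest) (paths d)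
      ≡⟨ cong (λ b → weigh (not b ∷ rest) (paths d)) (trans
           (cong (λ x → does (k ∣? x)) (sym (multiple k′ m))) (does-multiple (suc m))) ⟩
    weigh rest (paths d ∘ suc)
      ≡⟨ weigh-cong rest (λ h → sym (∑-pathsˡ d h)) ⟩
    weigh rest (λ h → ∑ (suc d) (λ i → paths i h))
      ≡⟨ weigh-∑ rest (suc d) paths ⟩
    ∑ (suc d) (λ i → weigh rest (paths i))
      ≡⟨ ∑-cong (suc d) (λ i → trans (weigh-nonmultiples m k′ i ≤-refl)
           (cong (forests k m ∘ suc) (+-comm i k′))) ⟩
    ∑ (suc d) (λ i → forests k m (k + i))
      ≡⟨ forests-∑ k m (suc d) ⟩
    forests k (suc m) (suc d)
      ≡⟨ cong (forests k (suc m) ∘ suc) (+-identityʳ d) ⟨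
    forests k (suc m) (suc (d + 0)) ∎
    where
    rest = nonmultiples k (m * k + k′)

    reindex : ∀ k′ m → suc m * suc k′ + 0 ≡ suc (m * suc k′ + k′)
    reindex = solve-∀

    multiple : ∀ k′ m → suc m * suc k′ ≡ suc (m * suc k′ + k′)
    multiple = solve-∀

-- Codes and their number.

-- Lehmer codes of the 132-avoiding permutations of suc n values with descents
-- prescribed by the Booleans.  The head of the vector concerns the first two
-- entries; the height is n minus the (0-based) first value.
mutual
  Code : Vec Bool n → Set
  Code []           = ⊤
  Code (false ∷ bs) = Code bs
  Code (true ∷ bs)  = Σ[ c ∈ Code bs ] Fin (suc (height bs c))

  height : (bs : Vec Bool n) → Code bs → ℕ
  height []           c       = 0
  height (false ∷ bs) c       = suc (height bs c)
  height (true ∷ bs)  (c , i) = toℕ i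

Σ-Fin-suc : ∀ {P : Fin (suc n) → Set} → Σ (Fin (suc n)) P ↔ (P zero ⊎ Σ (Fin n) (P ∘ suc))
Σ-Fin-suc = mk↔ₛ′
  (λ { (zero , x) → inj₁ x ; (suc i , x) → inj₂ (i , x) })
  (λ { (inj₁ x) → zero , x ; (inj₂ (i , x)) → suc i , x })
  (λ { (inj₁ x) → refl ; (inj₂ (i , x)) → refl })
  (λ { (zero , x) → refl ; (suc i , x) → refl })

Σ-Fin↔Fin-∑ : ∀ n (f : ℕ → ℕ) → (Σ[ i ∈ Fin n ] Fin (f (toℕ i))) ↔ Fin (∑ n f)
Σ-Fin↔Fin-∑ zero    f = mk↔ₛ′ proj₁ (λ ()) (λ ()) (λ ())
Σ-Fin↔Fin-∑ (suc n) f = ↔-trans Σ-Fin-suc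
  (↔-trans (↔-refl ⊎-↔ Σ-Fin↔Fin-∑ n (f ∘ suc)) (↔-sym +↔⊎))

-- The weight has to be arbitrary: at a descent the choice of `i` is absorbed into it, leaving codes
-- of `bs` weighted by a sum up to the height.
Σ-Code↔Fin : ∀ (bs : Vec Bool n) f →
  (Σ[ c ∈ Code bs ] Fin (f (height bs c))) ↔ Fin (weigh bs f)
Σ-Code↔Fin []           f = mk↔ₛ′ proj₂ (tt ,_) (λ _ → refl) (λ _ → refl)
Σ-Code↔Fin (false ∷ bs) f = Σ-Code↔Fin bs (f ∘ suc)
Σ-Code↔Fin (true ∷ bs)  f = ↔-trans Σ-assoc (↔-trans
  (Σ-congˡ (λ {c} → Σ-Fin↔Fin-∑ (suc (height bs c)) f))
  (Σ-Code↔Fin bs (λ h → ∑ (suc h) f)))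

Code↔Fin : ∀ (bs : Vec Bool n) → Code bs ↔ Fin (weigh bs (const 1))
Code↔Fin bs = ↔-trans
  (mk↔ₛ′ (_, zero) proj₁ (λ { (c , zero) → refl }) (λ _ → refl))
  (Σ-Code↔Fin bs (const 1))

-- Counting forests by removing the leftmost root.

Forest : (k m s : ℕ) → Set
Forest k m s = Σ[ ts ∈ Vec (Tree k) s ] internals ts ≡ m

Forest-≡ : ∀ {k m s} {F G : Forest k m s} → proj₁ F ≡ proj₁ G → F ≡ G
Forest-≡ {F = ts , p} {G = .ts , q} refl = cong (ts ,_) (≡-irrelevant p q)

internals-++ : ∀ {k s t} (ts : Vec (Tree k) s) (us : Vec (Tree k) t) →
  internals (ts ++ us) ≡ internals ts + internals us
internals-++ []       us = refl
internals-++ (t ∷ ts) us = trans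
  (cong (_+_ (internal t)) (internals-++ ts us))
  (sym (+-assoc (internal t) (internals ts) (internals us)))

leaves : ∀ {k} s (ts : Vec (Tree k) s) → internals ts ≡ 0 → ts ≡ replicate s leaf
leaves zero    []          _ = refl
leaves (suc s) (leaf ∷ ts) p = cong (leaf ∷_) (leaves s ts p)

internals-leaves : ∀ k s → internals (replicate s (leaf {k})) ≡ 0
internals-leaves k zero    = refl
internals-leaves k (suc s) = internals-leaves k s

module _ {k : ℕ} where

  uproot : ∀ {m s} → Forest k (suc m) (suc s) → Forest k (suc m) s ⊎ Forest k m (k + s)
  uproot (leaf ∷ ts    , p) = inj₁ (ts , p)
  uproot (node us ∷ ts , p) = inj₂ (us ++ ts , trans (internals-++ us ts) (suc-injective p))

  plant : ∀ {m s} → Forest k (suc m) s ⊎ Forest k m (k + s) → Forest k (suc m) (suc s)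
  plant (inj₁ (ts , p)) = leaf ∷ ts , p
  plant (inj₂ (ts , p)) with splitAt k ts
  ... | us , vs , refl = node us ∷ vs , cong suc (trans (sym (internals-++ us vs)) p)

  uproot-plant : ∀ {m s} (F : Forest k (suc m) s ⊎ Forest k m (k + s)) → uproot (plant F) ≡ F
  uproot-plant (inj₁ F) = refl
  uproot-plant (inj₂ (ts , p)) with splitAt k ts
  ... | us , vs , refl = cong inj₂ (Forest-≡ refl)

  plant-uproot : ∀ {m s} (F : Forest k (suc m) (suc s)) → plant (uproot F) ≡ F
  plant-uproot (leaf ∷ ts    , p) = refl
  -- The concatenation is abstracted as `ws` so that the equation returned by `splitAt` can be
  -- matched; `++-injective` then identifies the two splittings.
  plant-uproot (node us ∷ ts , p) with us ++ ts in eq | trans (internals-++ us ts) (suc-injective p)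
  ... | ws | q with splitAt k ws
  ... | us′ , ts′ , refl with refl , refl ← ++-injective us us′ eq = Forest-≡ refl

  -- The recursion is lexicographic in `(m, s)`: removing a leaf lowers `s`, while opening an
  -- internal root lowers `m` even though it enlarges the forest.
  Forest↔Fin : ∀ m s → Forest k m s ↔ Fin (forests k m s)
  Forest↔Fin zero    s       = mk↔ₛ′ (const zero)
    (const (replicate s leaf , internals-leaves k s))
    (λ { zero → refl }) (λ (ts , p) → Forest-≡ (sym (leaves s ts p)))
  Forest↔Fin (suc m) zero    = mk↔ₛ′ (λ { ([] , ()) }) (λ ()) (λ ()) (λ { ([] , ()) })
  Forest↔Fin (suc m) (suc s) = ↔-trans
    (mk↔ₛ′ uproot plant uproot-plant plant-uproot) (↔-trans
    (Forest↔Fin (suc m) s ⊎-↔ Forest↔Fin m (k + s)) (↔-sym +↔⊎))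

-- Prefixing a value to a permutation.

Contains132 : (Fin n → Fin n) → Set
Contains132 f = ∃[ i ] ∃[ j ] ∃[ l ]
  i Fin.< j × j Fin.< l × f i Fin.< f l × f l Fin.< f j

DescentsAt : Vec Bool n → (Fin (suc n) → Fin (suc n)) → Set
DescentsAt bs f = ∀ i → lookup bs i ≡ true ⇔ f (suc i) Fin.< f (inject₁ i)

Realises : Vec Bool n → (Fin (suc n) → Fin (suc n)) → Set
Realises bs f = DescentsAt bs f × ¬ Contains132 f

Realises-resp : ∀ (bs : Vec Bool n) {f g} → (∀ i → f i ≡ g i) → Realises bs f → Realises bs g
Realises-resp bs f≗g (des , av) =
  (λ i → subst₂ (λ x y → lookup bs i ≡ true ⇔ x Fin.< y) (f≗g (suc i)) (f≗g (inject₁ i)) (des i)) ,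
  λ (i , j , l , i<j , j<l , il , lj) → av (i , j , l , i<j , j<l ,
    subst₂ Fin._<_ (sym (f≗g i)) (sym (f≗g l)) il ,
    subst₂ Fin._<_ (sym (f≗g l)) (sym (f≗g j)) lj)

punchIn-below : ∀ (v : Fin (suc n)) x → x Fin.< v → punchIn v x Fin.< v
punchIn-below (suc v) zero    x<v       = z<s
punchIn-below (suc v) (suc x) (s<s x<v) = s<s (punchIn-below v x x<v)

punchIn-above : ∀ (v : Fin (suc n)) x → v Fin.≤ x → v Fin.< punchIn v x
punchIn-above zero    x       v≤x       = z<s
punchIn-above (suc v) (suc x) (s≤s v≤x) = s<s (punchIn-above v x v≤x)

punchIn-mono-< : ∀ (v : Fin (suc n)) {x y} → x Fin.< y → punchIn v x Fin.< punchIn v y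
punchIn-mono-< v {x} {y} x<y = ≰⇒> (<⇒≱ x<y ∘ punchIn-cancel-≤ v y x)

punchIn-cancel-< : ∀ (v : Fin (suc n)) {x y} → punchIn v x Fin.< punchIn v y → x Fin.< y
punchIn-cancel-< v {x} {y} x<y = ≰⇒> (<⇒≱ x<y ∘ punchIn-mono-≤ v y x)

punchIn-below⁻¹ : ∀ (v : Fin (suc n)) x → punchIn v x Fin.< v → x Fin.< v
punchIn-below⁻¹ v x lt = ≰⇒> (<-asym lt ∘ punchIn-above v x)

punchIn-above⁻¹ : ∀ (v : Fin (suc n)) x → v Fin.< punchIn v x → v Fin.≤ x
punchIn-above⁻¹ v x lt = ≮⇒≥ (<-asym lt ∘ punchIn-below v x)

-- In one-line notation, g is v followed by f, with the values of f from v
-- upwards raised by one.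
record Extends (v : Fin (suc n)) (f : Fin n → Fin n) (g : Fin (suc n) → Fin (suc n)) : Set where
  field
    head : g zero ≡ v
    tail : ∀ i → g (suc i) ≡ punchIn v (f i)

insert-extends : ∀ v (σ : Permutation′ n) → Extends v (σ ⟨$⟩ʳ_) (insert zero v σ ⟨$⟩ʳ_)
insert-extends v σ = record { head = refl ; tail = insert-punchIn zero v σ }

remove-extends : ∀ (π : Permutation′ (suc n)) →
  Extends (π ⟨$⟩ʳ zero) (remove zero π ⟨$⟩ʳ_) (π ⟨$⟩ʳ_)
remove-extends π = record { head = refl ; tail = punchIn-permute π zero }

Extends-unique : ∀ {v v′ : Fin (suc n)} {f f′ g g′} → Extends v f g → Extends v′ f′ g′ →
  v ≡ v′ → (∀ i → f i ≡ f′ i) → ∀ i → g i ≡ g′ i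
Extends-unique E E′ v≡ f≗ zero    = trans (Extends.head E) (trans v≡ (sym (Extends.head E′)))
Extends-unique E E′ v≡ f≗ (suc i) = trans (Extends.tail E i)
  (trans (cong₂ punchIn v≡ (f≗ i)) (sym (Extends.tail E′ i)))

Extends-cancel : ∀ {v v′ : Fin (suc n)} {f f′ g g′} → Extends v f g → Extends v′ f′ g′ →
  (∀ i → g i ≡ g′ i) → v ≡ v′ × (∀ i → f i ≡ f′ i)
Extends-cancel {v = v} {v′} {f} {f′} {g} {g′} E E′ g≗ = v≡ , λ i →
  punchIn-injective v (f i) (f′ i) (trans (sym (Extends.tail E i)) (trans (g≗ (suc i))
    (trans (Extends.tail E′ i) (cong (λ x → punchIn x (f′ i)) (sym v≡)))))
  where
  v≡ : v ≡ v′
  v≡ = trans (sym (Extends.head E)) (trans (g≗ zero) (Extends.head E′))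

module _ {v : Fin (suc (suc n))} {σ : Permutation′ (suc n)} {g}
  (E : Extends v (σ ⟨$⟩ʳ_) g) where
  open Extends E

  private
    f : Fin (suc n) → Fin (suc n)
    f = σ ⟨$⟩ʳ_

    head<⁺ : ∀ {i} → v Fin.≤ f i → g zero Fin.< g (suc i)
    head<⁺ {i} v≤ = subst₂ Fin._<_ (sym head) (sym (tail i)) (punchIn-above v (f i) v≤)

    head<⁻ : ∀ {i} → g zero Fin.< g (suc i) → v Fin.≤ f i
    head<⁻ {i} lt = punchIn-above⁻¹ v (f i) (subst₂ Fin._<_ head (tail i) lt)

    tail<⁺ : ∀ {i j} → f i Fin.< f j → g (suc i) Fin.< g (suc j)
    tail<⁺ {i} {j} lt = subst₂ Fin._<_ (sym (tail i)) (sym (tail j)) (punchIn-mono-< v lt)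

    tail<⁻ : ∀ {i j} → g (suc i) Fin.< g (suc j) → f i Fin.< f j
    tail<⁻ {i} {j} lt = punchIn-cancel-< v (subst₂ Fin._<_ (tail i) (tail j) lt)

  -- `punchIn v` keeps the values below `v` and lifts the others above it, so a descent at the front
  -- is a strict drop between the first two code entries, `v` and `f zero`.
  extends-descent : g (suc zero) Fin.< g zero ⇔ f zero Fin.< v
  extends-descent = mk⇔
    (λ lt → punchIn-below⁻¹ v (f zero) (subst₂ Fin._<_ (tail zero) head lt))
    (λ lt → subst₂ Fin._<_ (sym (tail zero)) (sym head) (punchIn-below v (f zero) lt))

  extends-descents : ∀ b (bs : Vec Bool n) → DescentsAt (b ∷ bs) g →
    (b ≡ true ⇔ f zero Fin.< v) × DescentsAt bs f
  extends-descents b bs des =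
    mk⇔ (Equivalence.to extends-descent ∘ Equivalence.to (des zero))
        (Equivalence.from (des zero) ∘ Equivalence.from extends-descent) ,
    λ i → mk⇔ (tail<⁻ ∘ Equivalence.to (des (suc i)))
              (Equivalence.from (des (suc i)) ∘ tail<⁺)

  extends-descents⁻¹ : ∀ b (bs : Vec Bool n) → (b ≡ true ⇔ f zero Fin.< v) → DescentsAt bs f →
    DescentsAt (b ∷ bs) g
  extends-descents⁻¹ b bs hd des zero = mk⇔
    (Equivalence.from extends-descent ∘ Equivalence.to hd)
    (Equivalence.from hd ∘ Equivalence.to extends-descent)
  extends-descents⁻¹ b bs hd des (suc i) = mk⇔
    (tail<⁺ ∘ Equivalence.to (des i))
    (Equivalence.from (des i) ∘ tail<⁻)

  -- With its converse below, this is the weak decrease of the Lehmer code at the front, since `v`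
  -- and `f zero` are its first two entries.
  extends-avoids : ¬ Contains132 g → ¬ Contains132 f × f zero Fin.≤ v
  extends-avoids av =
    (λ (i , j , l , i<j , j<l , il , lj) →
      av (suc i , suc j , suc l , s<s i<j , s<s j<l , tail<⁺ il , tail<⁺ lj)) ,
    ≮⇒≥ λ v<f0 → av (witness v<f0)
    where
    -- If v < f 0, the value v of f comes after f 0; raised to suc v, it is the
    -- last entry of a pattern that starts with g 0 = v and g 1.
    witness : v Fin.< f zero → Contains132 g
    witness v<f0 = zero , suc zero , suc l , z<s , s<s l>0 ,
      head<⁺ (≤-reflexive (sym fl≡v)) ,
      tail<⁺ (subst (_< toℕ (f zero)) (sym fl≡v) v<f0)
      where
      x<n : toℕ v < suc n
      x<n = <-trans v<f0 (toℕ<n (f zero))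

      l : Fin (suc n)
      l = σ ⟨$⟩ˡ fromℕ< x<n

      fl≡v : toℕ (f l) ≡ toℕ v
      fl≡v = trans (cong toℕ (inverseʳ σ)) (toℕ-fromℕ< x<n)

      l>0 : 0 < toℕ l
      l>0 = n≢0⇒n>0 λ l≡0 → <-irrefl
        (trans (sym fl≡v) (cong (toℕ ∘ f) (toℕ-injective l≡0))) v<f0

  -- A pattern starting at the new entry gives `f zero ≤ v ≤ f l`. If its largest entry is `g 1`,
  -- this contradicts `f l < f zero`; otherwise `f zero` can replace the new entry, which yields a
  -- pattern inside `f`.
  extends-avoids⁻¹ : ¬ Contains132 f → f zero Fin.≤ v → ¬ Contains132 g
  extends-avoids⁻¹ av f0≤v (suc i , suc j , suc l , s<s i<j , s<s j<l , il , lj) =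
    av (i , j , l , i<j , j<l , tail<⁻ il , tail<⁻ lj)
  extends-avoids⁻¹ av f0≤v (zero , suc zero , suc l , _ , _ , il , lj) =
    <⇒≱ (tail<⁻ lj) (≤-trans f0≤v (head<⁻ il))
  extends-avoids⁻¹ av f0≤v (zero , suc (suc j) , suc l , _ , s<s j<l , il , lj) =
    av (zero , suc j , l , z<s , j<l , ≤∧≢⇒< (≤-trans f0≤v (head<⁻ il)) f0≢fl , tail<⁻ lj)
    where
    f0≢fl : toℕ (f zero) ≢ toℕ (f l)
    f0≢fl eq = <⇒≢ (≤-<-trans z≤n j<l)
      (cong toℕ (Injection.injective (↔⇒↣ σ) (toℕ-injective eq)))

  extends-realises : ∀ b (bs : Vec Bool n) → Realises (b ∷ bs) g →
    Realises bs f × (b ≡ true ⇔ f zero Fin.< v) × f zero Fin.≤ v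
  extends-realises b bs (des , av) with extends-descents b bs des | extends-avoids av
  ... | hd , des′ | av′ , f0≤v = (des′ , av′) , hd , f0≤v

  extends-realises⁻¹ : ∀ b (bs : Vec Bool n) → Realises bs f →
    (b ≡ true ⇔ f zero Fin.< v) → f zero Fin.≤ v → Realises (b ∷ bs) g
  extends-realises⁻¹ b bs (des , av) hd f0≤v =
    extends-descents⁻¹ b bs hd des , extends-avoids⁻¹ av f0≤v

-- Decoding and encoding permutations.

height≤n : ∀ (bs : Vec Bool n) c → height bs c ≤ n
height≤n []           c       = z≤n
height≤n (false ∷ bs) c       = s≤s (height≤n bs c)
height≤n (true ∷ bs)  (c , i) = ≤-trans (toℕ≤pred[n] i) (m≤n⇒m≤1+n (height≤n bs c))

-- A non-descent repeats the code entry. At a descent `i` counts down from the top value, giving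
-- `suc n - i`; as `i` is at most the height `n - x`, for `x` the first value of the decoded tail,
-- this always exceeds `x`.
first-value : ∀ b (bs : Vec Bool n) → Code (b ∷ bs) → Fin (suc n) → Fin (suc (suc n))
first-value false bs c       x = inject₁ x
first-value true  bs (c , i) x = opposite (inject≤ i (s≤s (m≤n⇒m≤1+n (height≤n bs c))))

remaining : ∀ b {bs : Vec Bool n} → Code (b ∷ bs) → Code bs
remaining false c       = c
remaining true  (c , i) = c

decode : (bs : Vec Bool n) → Code bs → Permutation′ (suc n)
decode []       c = Perm.id
decode (b ∷ bs) c = insert zero (first-value b bs c (σ ⟨$⟩ʳ zero)) σ
  where
  σ = decode bs (remaining b c)

toℕ-first-value : ∀ (bs : Vec Bool n) c i x → toℕ (first-value true bs (c , i) x) ≡ suc n ∸ toℕ i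
toℕ-first-value bs c i x = trans (opposite-prop (inject≤ i (s≤s (m≤n⇒m≤1+n (height≤n bs c)))))
  (cong (_ ∸_) (toℕ-inject≤ i (s≤s (m≤n⇒m≤1+n (height≤n bs c)))))

decode-head : ∀ (bs : Vec Bool n) c → toℕ (decode bs c ⟨$⟩ʳ zero) ≡ n ∸ height bs c
decode-head []           c       = refl
decode-head (false ∷ bs) c       = trans (toℕ-inject₁ _) (decode-head bs c)
decode-head (true ∷ bs)  (c , i) = toℕ-first-value bs c i (decode bs c ⟨$⟩ʳ zero)

decode-realises : ∀ (bs : Vec Bool n) c → Realises bs (decode bs c ⟨$⟩ʳ_)
decode-realises []           c = (λ ()) , λ { (zero , zero , _ , () , _) }
decode-realises (false ∷ bs) c = extends-realises⁻¹ {σ = σ}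
  (insert-extends (first-value false bs c (σ ⟨$⟩ʳ zero)) σ) false bs (decode-realises bs c)
  (mk⇔ (λ ()) (⊥-elim ∘ <-irrefl (sym (toℕ-inject₁ _))))
  (≤-reflexive (sym (toℕ-inject₁ _)))
  where
  σ = decode bs c
decode-realises {suc n} (true ∷ bs) (c , i) = extends-realises⁻¹ {σ = σ}
  (insert-extends (first-value true bs (c , i) (σ ⟨$⟩ʳ zero)) σ) true bs (decode-realises bs c)
  (mk⇔ (λ _ → below) (λ _ → refl)) (<⇒≤ below)
  where
  σ = decode bs c

  below : σ ⟨$⟩ʳ zero Fin.< first-value true bs (c , i) (σ ⟨$⟩ʳ zero)
  below = subst₂ _<_ (sym (decode-head bs c)) (sym (toℕ-first-value bs c i (σ ⟨$⟩ʳ zero)))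
    (subst (suc (n ∸ height bs c) ≤_) (sym (+-∸-assoc 1 (≤-trans (toℕ≤pred[n] i) (height≤n bs c))))
      (s≤s (∸-monoʳ-≤ n (toℕ≤pred[n] i))))

decode-injective : ∀ (bs : Vec Bool n) {c c′} → decode bs c ≈ decode bs c′ → c ≡ c′
decode-injective []           eq = refl
decode-injective (false ∷ bs) eq = decode-injective bs
  (proj₂ (Extends-cancel (insert-extends _ (decode bs _)) (insert-extends _ (decode bs _)) eq))
decode-injective {suc n} (true ∷ bs) {c , i} {c′ , i′} eq
  with Extends-cancel (insert-extends _ (decode bs c)) (insert-extends _ (decode bs c′)) eq
-- The tails are identified first, because the types of `i` and `i′` depend on `c` and `c′`.
... | v≡v′ , σ≈σ′ with refl ← decode-injective bs {c} {c′} σ≈σ′ =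
  cong (c ,_) (inject≤-injective _ _ i i′ (trans (sym (opposite-involutive _))
    (trans (cong opposite v≡v′) (opposite-involutive _))))

encode : ∀ (bs : Vec Bool n) π → Realises bs (π ⟨$⟩ʳ_) → Σ[ c ∈ Code bs ] decode bs c ≈ π
encode []           π R = tt , λ { zero → Fin1-unique _ _ }
  where
  Fin1-unique : ∀ (i j : Fin 1) → i ≡ j
  Fin1-unique zero zero = refl
encode (false ∷ bs) π R with extends-realises {σ = remove zero π} (remove-extends π) false bs R
... | Rσ , hd , ≤v with encode bs (remove zero π) Rσ
... | c , c≈σ = c , Extends-unique (insert-extends _ (decode bs c)) (remove-extends π)
  (toℕ-injective (trans (toℕ-inject₁ _) (trans (cong toℕ (c≈σ zero))
    -- Avoidance bounds the second code entry by the first, and the absence of a descent excludes a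
    -- strict drop.
    (≤-antisym ≤v (≮⇒≥ λ lt → contradiction (Equivalence.from hd lt) λ ())))))
  c≈σ
encode {suc n} (true ∷ bs) π R with extends-realises {σ = remove zero π} (remove-extends π) true bs R
... | Rσ , hd , ≤v with encode bs (remove zero π) Rσ
... | c , c≈σ = (c , i) , Extends-unique (insert-extends _ (decode bs c)) (remove-extends π)
  (toℕ-injective (trans (toℕ-first-value bs c i (decode bs c ⟨$⟩ʳ zero))
    (trans (cong (suc n ∸_) (toℕ-fromℕ< bound)) (m∸[m∸n]≡n (toℕ≤pred[n] v)))))
  c≈σ
  where
  v = π ⟨$⟩ʳ zero

  head<v : n ∸ height bs c < toℕ v
  head<v = subst (_< toℕ v) (trans (cong toℕ (sym (c≈σ zero))) (decode-head bs c))
    (Equivalence.to hd refl)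

  -- The choice `i` is recovered as `suc n ∸ v`, inverting the count from the top; the descent at
  -- the front keeps it within the height.
  bound : suc n ∸ toℕ v < suc (height bs c)
  bound = s≤s (≤-trans (∸-monoʳ-≤ (suc n) head<v)
    (≤-reflexive (m∸[m∸n]≡n (height≤n bs c))))

  i = fromℕ< bound

-- The permutation `τ` of positions is the identity for 132 and the reversal for 231. Congruence
-- reduces to injectivity of `decode`: however the membership proofs differ, the codes decode to the
-- same permutation.
codes : ∀ (bs : Vec Bool n) (P : Pred (Permutation′ (suc n)) 0ℓ) (τ : Permutation′ (suc n)) →
  (∀ π → P π ⇔ Realises bs ((τ ∘ₚ π) ⟨$⟩ʳ_)) →
  Bijection (On.setoid {B = Σ (Permutation′ (suc n)) P}
    (Fin (suc n) →-setoid Fin (suc n)) (λ x → proj₁ x ⟨$⟩ʳ_)) (setoid (Code bs))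
codes bs P τ P⇔ = record
  { to        = proj₁ ∘ code
  ; cong      = λ {x} {y} x≈y → decode-injective bs (λ i →
      trans (proj₂ (code x) i) (trans (x≈y _) (sym (proj₂ (code y) i))))
  ; bijective =
      (λ {x} {y} eq i → trans (sym (decoded x i)) (trans
        (cong (λ c → decode bs c ⟨$⟩ʳ (τ ⟨$⟩ˡ i)) eq) (decoded y i))) ,
      λ c → (flip τ ∘ₚ decode bs c ,
             Equivalence.from (P⇔ _) (Realises-resp bs
               (λ i → cong (decode bs c ⟨$⟩ʳ_) (sym (inverseˡ τ))) (decode-realises bs c))) ,
            λ {z} z≈ → decode-injective bs (λ i → trans (proj₂ (code z) i) (trans (z≈ _)
              (cong (decode bs c ⟨$⟩ʳ_) (inverseˡ τ))))
  }
  where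
  code : (x : Σ (Permutation′ _) P) → Σ[ c ∈ Code bs ] decode bs c ≈ τ ∘ₚ proj₁ x
  code (π , p) = encode bs (τ ∘ₚ π) (Equivalence.to (P⇔ π) p)

  decoded : ∀ x i → decode bs (proj₁ (code x)) ⟨$⟩ʳ (τ ⟨$⟩ˡ i) ≡ proj₁ x ⟨$⟩ʳ i
  decoded x i = trans (proj₂ (code x) (τ ⟨$⟩ˡ i)) (cong (proj₁ x ⟨$⟩ʳ_) (inverseʳ τ))

-- Pattern occurrences as triples of positions.

ascending : ∀ {x y z : Fin n} → x Fin.< y → y Fin.< z → ∀ a b →
  a Fin.< b ⇔ lookup (x ∷ y ∷ z ∷ []) a Fin.< lookup (x ∷ y ∷ z ∷ []) b
ascending {n} {x} {y} {z} x<y y<z = go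
  where
  both : ∀ {a b} {A : Set a} {B : Set b} → A → B → A ⇔ B
  both a b = mk⇔ (const b) (const a)

  neither : ∀ {a b} {A : Set a} {B : Set b} → ¬ A → ¬ B → A ⇔ B
  neither ¬a ¬b = mk⇔ (λ a → contradiction a ¬a) (λ b → contradiction b ¬b)

  x<z : x Fin.< z
  x<z = <-trans x<y y<z

  go : ∀ a b → a Fin.< b ⇔ lookup (x ∷ y ∷ z ∷ []) a Fin.< lookup (x ∷ y ∷ z ∷ []) b
  go 0F 0F = neither (λ ()) (<-irrefl refl)
  go 0F 1F = both z<s x<y
  go 0F 2F = both z<s x<z
  go 1F 0F = neither (λ ()) (<-asym x<y)
  go 1F 1F = neither (<-irrefl refl) (<-irrefl refl)
  go 1F 2F = both (s<s z<s) y<z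
  go 2F 0F = neither (λ ()) (<-asym x<z)
  go 2F 1F = neither (λ { (s<s ()) }) (<-asym y<z)
  go 2F 2F = neither (<-irrefl refl) (<-irrefl refl)

-- Here x < y < z are the three values, and position a carries the one whose
-- rank is listed at a.
occurrence : ∀ (π : Permutation′ n) (ranks : Vec (Fin 3) 3) {i j l x y z} →
  i Fin.< j → j Fin.< l → x Fin.< y → y Fin.< z →
  (∀ a → π ⟨$⟩ʳ lookup (i ∷ j ∷ l ∷ []) a ≡ lookup (x ∷ y ∷ z ∷ []) (lookup ranks a)) →
  Contains π (Vec.map (suc ∘ toℕ) ranks)
occurrence π ranks i<j j<l x<y y<z π≡ =
  -- `ascending` serves twice: here for the positions, and in `iso` for the values.
  _ , (λ {a} {b} → Equivalence.to (ascending i<j j<l a b)) , λ a b →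
    subst₂ (λ u v → u < v ⇔ π ⟨$⟩ʳ _ Fin.< π ⟨$⟩ʳ _)
      (sym (lookup-map a (suc ∘ toℕ) ranks)) (sym (lookup-map b (suc ∘ toℕ) ranks))
      (mk⇔
        (λ { (s<s lt) → subst₂ Fin._<_ (sym (π≡ a)) (sym (π≡ b)) (Equivalence.to (iso a b) lt) })
        (λ lt → s<s (Equivalence.from (iso a b) (subst₂ Fin._<_ (π≡ a) (π≡ b) lt))))
  where
  iso : ∀ a b → _
  iso a b = ascending x<y y<z (lookup ranks a) (lookup ranks b)

contains-132 : ∀ (π : Permutation′ n) → Contains π p132 ⇔ Contains132 (π ⟨$⟩ʳ_)
contains-132 π = mk⇔
  (λ (f , mono , iso) → f 0F , f 1F , f 2F , mono z<s , mono (s<s z<s) ,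
    Equivalence.to (iso 0F 2F) (s<s z<s) , Equivalence.to (iso 2F 1F) (s<s (s<s z<s)))
  (λ (i , j , l , i<j , j<l , il , lj) →
    -- The ranks are the pattern entries lowered by one; in increasing order the values sit at `i`,
    -- `l`, `j`.
    occurrence π (0F ∷ 2F ∷ 1F ∷ []) i<j j<l il lj λ { 0F → refl ; 1F → refl ; 2F → refl })

opposite-anti-< : ∀ {i j : Fin n} → i Fin.< j → opposite j Fin.< opposite i
opposite-anti-< {n} {i} {j} i<j =
  subst₂ _<_ (sym (opposite-prop j)) (sym (opposite-prop i)) (∸-monoʳ-< (s<s i<j) (toℕ<n j))

contains-231 : ∀ (π : Permutation′ n) → Contains π p231 ⇔ Contains132 (λ i → π ⟨$⟩ʳ opposite i)
contains-231 π = mk⇔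
  (λ (f , mono , iso) → opposite (f 2F) , opposite (f 1F) , opposite (f 0F) ,
    opposite-anti-< (mono (s<s z<s)) , opposite-anti-< (mono z<s) ,
    twice (Equivalence.to (iso 2F 0F) (s<s z<s)) , twice (Equivalence.to (iso 0F 1F) (s<s (s<s z<s))))
  (λ (i , j , l , i<j , j<l , il , lj) →
    occurrence π (1F ∷ 2F ∷ 0F ∷ []) (opposite-anti-< j<l) (opposite-anti-< i<j) il lj
      λ { 0F → refl ; 1F → refl ; 2F → refl })
  where
  twice : ∀ {x y} → π ⟨$⟩ʳ x Fin.< π ⟨$⟩ʳ y →
    π ⟨$⟩ʳ opposite (opposite x) Fin.< π ⟨$⟩ʳ opposite (opposite y)
  twice {x} {y} = subst₂ (λ u v → π ⟨$⟩ʳ u Fin.< π ⟨$⟩ʳ v)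
    (sym (opposite-involutive x)) (sym (opposite-involutive y))

-- Prescribed descent sets as Boolean words.

MultipleDescents : ℕ → Permutation′ (suc n) → Set
MultipleDescents {n} k π = ∀ (i : Fin n) → k ∣ suc (toℕ i) ⇔ π ⟨$⟩ʳ suc i Fin.< π ⟨$⟩ʳ inject₁ i

module _ {k : ℕ} .{{_ : NonTrivial k}} where
  private
    instance
      k≢0 : NonZero k
      k≢0 = nonTrivial⇒nonZero k

  ∣⇒multiple : ∀ {i} → i < n → k ∣ suc i → Multiples (suc n) k (suc i)
  ∣⇒multiple {n} i<n (divides q eq) =
    q ,
    n≢0⇒n>0 (λ { refl → contradiction eq λ () }) ,
    subst (_≤ n ℕ./ k) (trans (cong (ℕ._/ k) eq) (m*n/n≡m q k)) (/-monoˡ-≤ k i<n) ,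
    trans eq (*-comm q k)

  multiple⇒∣ : ∀ {x} → Multiples (suc n) k x → k ∣ x
  multiple⇒∣ (j , _ , _ , eq) = divides j (trans eq (*-comm k j))

  multiples-bounded : ∀ {x} → Multiples (suc n) k x → ∃[ i ] i < n × x ≡ suc i
  multiples-bounded {n} {zero}  (suc j , _ , _ , eq) = contradiction (sym eq)
    (≢-nonZero⁻¹ (k * suc j) {{m*n≢0 k (suc j)}})
  multiples-bounded {n} {suc i} (j , _ , j≤ , eq) = i ,
    subst (_≤ n) (sym eq) (≤-trans (*-monoʳ-≤ k j≤)
      (subst (_≤ n) (*-comm (n ℕ./ k) k) (m/n*n≤m n k))) ,
    refl

  descent : ∀ (π : Permutation′ (suc n)) (i : Fin n) →
    Des π (suc (toℕ i)) ⇔ π ⟨$⟩ʳ suc i Fin.< π ⟨$⟩ʳ inject₁ i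
  descent π i = mk⇔
    (λ (a , b , a≡ , b≡ , lt) → subst₂ (λ x y → π ⟨$⟩ʳ x Fin.< π ⟨$⟩ʳ y)
      (toℕ-injective (suc-injective b≡))
      (toℕ-injective (trans (suc-injective a≡) (sym (toℕ-inject₁ i)))) lt)
    (λ lt → inject₁ i , suc i , cong suc (toℕ-inject₁ i) , refl , lt)

  descent-bounded : ∀ (π : Permutation′ (suc n)) {x} → Des π x → ∃[ i ] i < n × x ≡ suc i
  descent-bounded π (a , b , refl , b≡ , _) =
    toℕ a , s<s⁻¹ (subst (_< suc _) (suc-injective b≡) (toℕ<n b)) , refl

  -- The bound on the multiplier says that the multiple lies among `1, ..., n`, and descent
  -- positions lie there too, so the equality of predicates on `ℕ` becomes one equivalence per
  -- element of `Fin n`.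
  InD⇔ : ∀ (π : Permutation′ (suc n)) → InD (suc n) k π ⇔ MultipleDescents k π
  InD⇔ {n} π = mk⇔ local λ D → to D , from D
    where
    local : InD (suc n) k π → MultipleDescents k π
    local (des⇒ , des⇐) i = mk⇔
      (λ d → Equivalence.to (descent π i) (des⇐ (∣⇒multiple (toℕ<n i) d)))
      (λ lt → multiple⇒∣ {n} (des⇒ (Equivalence.from (descent π i) lt)))

    index : ∀ {i} → i < n → Σ[ a ∈ Fin n ] i ≡ toℕ a
    index i<n = fromℕ< i<n , sym (toℕ-fromℕ< i<n)

    to : MultipleDescents k π → ∀ {x} → Des π x → Multiples (suc n) k x
    to D d with descent-bounded π d
    ... | i , i<n , refl with index i<n
    ... | a , refl = ∣⇒multiple i<n (Equivalence.from (D a) (Equivalence.to (descent π a) d))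

    from : MultipleDescents k π → ∀ {x} → Multiples (suc n) k x → Des π x
    from D d with multiples-bounded {n} d
    ... | i , i<n , refl with index i<n
    ... | a , refl = Equivalence.from (descent π a) (Equivalence.to (D a) (multiple⇒∣ {n} d))

does-true : ∀ {A : Set} (a? : Dec A) → does a? ≡ true ⇔ A
does-true (yes a) = mk⇔ (const a) (const refl)
does-true (no ¬a) = mk⇔ (λ ()) (λ a → contradiction a ¬a)

-- Both sides of an equivalence are negated; for distinct values the negation of `x < y` is `y < x`.
not-does : ∀ {A : Set} (a? : Dec A) {x y : Fin n} → x ≢ y →
  (A ⇔ x Fin.< y) ⇔ (not (does a?) ≡ true ⇔ y Fin.< x)
not-does (yes a) x≢y = mk⇔
  (λ e → mk⇔ (λ ()) (λ lt → contradiction lt (<-asym (Equivalence.to e a))))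
  (λ e → mk⇔ (λ _ → ≤∧≢⇒< (≮⇒≥ (λ lt → contradiction (Equivalence.from e lt) λ ()))
                           (x≢y ∘ toℕ-injective))
             (const a))
not-does (no ¬a) x≢y = mk⇔
  (λ e → mk⇔ (λ _ → ≤∧≢⇒< (≮⇒≥ (¬a ∘ Equivalence.from e)) (x≢y ∘ sym ∘ toℕ-injective)) (const refl))
  (λ e → mk⇔ (λ a → contradiction a ¬a) (λ lt → contradiction lt (<-asym (Equivalence.to e refl))))

Π-⇔ : ∀ {A : Set} {P Q : A → Set} → (∀ x → P x ⇔ Q x) → (∀ x → P x) ⇔ (∀ x → Q x)
Π-⇔ P⇔Q = mk⇔ (λ p x → Equivalence.to (P⇔Q x) (p x)) (λ q x → Equivalence.from (P⇔Q x) (q x))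

descents-at-⇔ : ∀ p (f : Fin (suc n) → Fin (suc n)) →
  DescentsAt (descents-at n p) f ⇔ (∀ i → p (toℕ i) ≡ true ⇔ f (suc i) Fin.< f (inject₁ i))
descents-at-⇔ p f = Π-⇔ λ i → mk⇔
  (subst (λ b → b ≡ true ⇔ f (suc i) Fin.< f (inject₁ i)) (lookup∘tabulate (p ∘ toℕ) i))
  (subst (λ b → b ≡ true ⇔ f (suc i) Fin.< f (inject₁ i)) (sym (lookup∘tabulate (p ∘ toℕ) i)))

⇔-congˡ : ∀ {A B C : Set} → A ⇔ B → (A ⇔ C) ⇔ (B ⇔ C)
⇔-congˡ A⇔B = mk⇔ (_⇔-∘ ⇔-sym A⇔B) (_⇔-∘ A⇔B)

module _ {k : ℕ} .{{_ : NonTrivial k}} (π : Permutation′ (suc n)) where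

  realises-132 : (InD (suc n) k π × Avoids p132 π) ⇔
    Realises (multiples k n) (π ⟨$⟩ʳ_)
  realises-132 = (⇔-sym (descents-at-⇔ (λ i → does (k ∣? suc i)) (π ⟨$⟩ʳ_)) ⇔-∘
      (Π-⇔ (λ i → ⇔-congˡ (⇔-sym (does-true (k ∣? suc (toℕ i))))) ⇔-∘ InD⇔ π))
    ×-⇔ ¬-cong-⇔ (contains-132 π)

  private
    ρ : Permutation′ (suc n)
    ρ = Perm.reverse ∘ₚ π

    opposite-inject₁ : ∀ (i : Fin n) → opposite (inject₁ i) ≡ suc (opposite i)
    opposite-inject₁ i = trans (cong opposite (cong inject₁ (sym (opposite-involutive i))))
      (opposite-involutive (suc (opposite i)))

    -- This accounts for `n ∸ i` in `nonmultiples`: the adjacent pair at index `i` of the reversed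
    -- word is the pair at one-based position `n ∸ i` of `π`.
    suc-opposite : ∀ (i : Fin n) → suc (toℕ (opposite i)) ≡ n ∸ toℕ i
    suc-opposite i = trans (cong suc (opposite-prop i)) (sym (+-∸-assoc 1 (toℕ<n i)))

    reindex : ∀ {P : Fin n → Set} → (∀ i → P i) ⇔ (∀ i → P (opposite i))
    reindex {P} = mk⇔ (λ p i → p (opposite i))
      (λ p i → subst P (opposite-involutive i) (p (opposite i)))

    ascent⇔descent : ∀ i →
      (k ∣ suc (toℕ (opposite i)) ⇔ π ⟨$⟩ʳ suc (opposite i) Fin.< π ⟨$⟩ʳ inject₁ (opposite i)) ⇔
      (not (does (k ∣? n ∸ toℕ i)) ≡ true ⇔ ρ ⟨$⟩ʳ suc i Fin.< ρ ⟨$⟩ʳ inject₁ i)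
    ascent⇔descent i rewrite suc-opposite i | opposite-inject₁ i =
      not-does (k ∣? n ∸ toℕ i) λ eq → contradiction
        (trans (cong toℕ (Injection.injective (↔⇒↣ π) eq)) (toℕ-inject₁ (opposite i))) 1+n≢n

  realises-231 : (InD (suc n) k π × Avoids p231 π) ⇔
    Realises (nonmultiples k n) (ρ ⟨$⟩ʳ_)
  realises-231 = (⇔-sym (descents-at-⇔ (λ i → not (does (k ∣? n ∸ i))) (ρ ⟨$⟩ʳ_)) ⇔-∘
      (Π-⇔ ascent⇔descent ⇔-∘ (reindex ⇔-∘ InD⇔ π)))
    ×-⇔ ¬-cong-⇔ (contains-231 π)

-- The rational formula and the assembly of both families.

cross-multiplied : ∀ n c s b → suc n * c ≡ s * b →
  -- Unnormalised rationals involve no reduction by common factors, so equality there is an equation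
  -- between integers.
  (+ c ℚ./ 1) ≡ (+ s ℚ./ suc n) ℚ.* (+ b ℚ./ 1)
cross-multiplied n c s b eq = ℚ.toℚᵘ-injective
  (ℚᵘ.≃-trans (ℚ.toℚᵘ-fromℚᵘ (ℚᵘ.mkℚᵘ (+ c) 0))
  (ℚᵘ.≃-trans (ℚᵘ.*≡* integral) (ℚᵘ.≃-sym
  (ℚᵘ.≃-trans (ℚ.toℚᵘ-homo-* (+ s ℚ./ suc n) (+ b ℚ./ 1))
    (ℚᵘ.*-cong (ℚ.toℚᵘ-fromℚᵘ (ℚᵘ.mkℚᵘ (+ s) n)) (ℚ.toℚᵘ-fromℚᵘ (ℚᵘ.mkℚᵘ (+ b) 0)))))))
  where
  integral : + c ℤ.* + (suc n * 1) ≡ (+ s ℤ.* + b) ℤ.* + 1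
  integral = trans (sym (ℤ.pos-* c (suc n * 1))) (trans
    (cong +_ (trans (cong (c *_) (*-identityʳ (suc n))) (trans (*-comm c (suc n)) eq)))
    (trans (ℤ.pos-* s b) (sym (ℤ.*-identityʳ (+ s ℤ.* + b)))))

theorem3p1 : (k m s N : ℕ) .{{_ : NonTrivial k}} .{{_ : NonZero N}} →
    1 ≤ s → s ≤ k → N ≡ m * k + s →
    Bijection (𝒟 N k p132) (ℱ k m s) ×
    Bijection (𝒟 N k p231) (ℱ k m s) ×
    (∃[ c ] HasCardinality (𝒟 N k p132) c ×
    HasCardinality (𝒟 N k p231) c ×
    (+ c / 1) ≡ (+ s / N) ℚ.* (+ (N C m) / 1))
theorem3p1 k@(suc k′) m s@(suc r) N@(suc n) _ (s≤s r≤k′) N≡ =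
  Composition.bijection card-132 forest ,
  Composition.bijection card-231 forest ,
  forests k m s , card-132 , card-231 , cross-multiplied n (forests k m s) s (N C m) closed
  where
  -- With `s = suc r`, the `n` adjacent pairs form `m` full blocks of length `k` and `r < k` further
  -- pairs.
  n≡ : n ≡ m * k + r
  n≡ = suc-injective (trans N≡ (+-suc (m * k) r))

  forest : Bijection (setoid (Fin (forests k m s))) (ℱ k m s)
  forest = Inverse⇒Bijection (↔-sym (Forest↔Fin m s))

  card : ∀ (bs : Vec Bool n) → weigh bs (const 1) ≡ forests k m s →
    Bijection (setoid (Code bs)) (setoid (Fin (forests k m s)))
  card bs eq = subst (λ c → Bijection (setoid (Code bs)) (setoid (Fin c))) eq
    (Inverse⇒Bijection (Code↔Fin bs))

  card-132 : HasCardinality (𝒟 N k p132) (forests k m s)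
  card-132 = Composition.bijection (codes (multiples k n) _ Perm.id realises-132)
    (card (multiples k n) (begin
      weigh (multiples k n) (const 1)
        ≡⟨ cong (λ x → weigh (multiples k x) (const 1)) n≡ ⟩
      weigh (multiples k (m * k + r)) (const 1)
        -- At `j = 0` the weight `forests k 0 ∘ suc` is constantly `1`.
        ≡⟨ weigh-multiples k′ m r 0 (λ i → does (k ∣? suc i)) r≤k′ (λ _ → refl) ⟩
      forests k (m + 0) s
        ≡⟨ cong (λ x → forests k x s) (+-identityʳ m) ⟩
      forests k m s ∎))

  card-231 : HasCardinality (𝒟 N k p231) (forests k m s)
  card-231 = Composition.bijection (codes (nonmultiples k n) _ Perm.reverse realises-231)
    (card (nonmultiples k n) (begin
      weigh (nonmultiples k n) (const 1)
        ≡⟨ cong (λ x → weigh (nonmultiples k x) (const 1)) n≡ ⟩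
      weigh (nonmultiples k (m * k + r)) (const 1)
        -- At `d = 0` the kernel `paths 0` is constantly `1`.
        ≡⟨ weigh-nonmultiples k′ m r 0 r≤k′ ⟩
      forests k m s ∎))

  closed : N * forests k m s ≡ s * (N C m)
  closed = subst (λ x → x * forests k m s ≡ s * (x C m))
    (trans (+-comm s (m * k)) (sym N≡)) (forests-closed k m s)
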